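{- Let $n\geq 1$. Consider $n$ gossipers, each initially knowing only their own distinct piece of gossip. A phone call between two distinct gossipers results in both knowing the union of what the two knew before the call. Then any sequence of phone calls such that in each call at least one of the two participants learns something new has length at most $\binom{n}{2}$, and for every $n$ there exists such a sequence of length exactly $\binom{n}{2}$. -}

module Defs where

open import Data.Nat using (ℕ)
open import Data.Fin using (Fin)
open import Data.Fin.Properties using (_≟_)
open import Data.Fin.Subset using (Subset; ⁅_⁆; _∪_; _⊆_)
open import Data.Product using (Σ; _×_; _,_)
open import Data.Sum using (_⊎_)
open import Data.List using (List; []; _∷_)
open import Relation.Nullary using (¬_; yes; no)
open import Relation.Binary.PropositionalEquality using (_≡_)

-- What each of the n gossipers knows: gossiper k knows the pieces in (s k).
State : ℕ → Set
State n = Fin n → Subset n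

initial : (n : ℕ) → State n
initial n i = ⁅ i ⁆

Call : ℕ → Set
Call n = Σ (Fin n) λ i → Σ (Fin n) λ j → ¬ (i ≡ j)

applyCall : {n : ℕ} → Call n → State n → State n
applyCall (i , j , _) s k with k ≟ i | k ≟ j
... | yes _ | _     = s i ∪ s j
... | no _  | yes _ = s i ∪ s j
... | no _  | no _  = s k

Informative : {n : ℕ} → State n → Call n → Set
Informative s (i , j , _) = (¬ (s j ⊆ s i)) ⊎ (¬ (s i ⊆ s j))

data ValidSeq {n : ℕ} : State n → List (Call n) → Set where
  done : ∀ {s} → ValidSeq s []
  step : ∀ {s c cs} → Informative s c → ValidSeq (applyCall c s) cs → ValidSeq s (c ∷ cs)

{-# OPTIONS --safe #-}

-- Upper bound. Weight each piece of gossip x, as known to person p, by an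
-- integer y x p that is positive exactly when p knows x; a call between i and
-- j acts on the weights by the invertible matrix T = (1 1; 1 2), whose entries
-- are positive, so that both participants acquire the union of the supports.
-- Call an alternating bilinear form B on ℤⁿ compatible with the situation if
-- B (y x) (e p) = 0 whenever p does not know x.  Transporting along T sends
-- forms compatible before the call to forms compatible after it.  The form
-- uᵢ vⱼ - uⱼ vᵢ is always compatible after the call, and it was compatible
-- before the call only if i and j knew the same.  So each informative call
-- raises the dimension of the space of compatible forms, which is at most
-- n C 2.
--
-- Lower bound. The first person calls all others in turn, hearing a new piece
-- each time.  Afterwards each of the others still ignores the pieces of those
-- called later, so they can proceed in the same way without the first person.

module Submission where

open import Defs
open import Data.Nat using (ℕ; zero; suc; _≤_; z≤n; s≤s)
import Data.Nat as ℕ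
import Data.Nat.Properties as ℕₚ
open import Data.Nat.Combinatorics using (_C_; nC1≡n; nCk+nC[k+1]≡[n+1]C[k+1])
open import Data.Integer using (ℤ; 0ℤ; 1ℤ; -1ℤ; +_; _+_; _*_; -_; _-_; _<_; _≟_; +<+)
import Data.Integer as ℤ
import Data.Integer.Properties as ℤₚ
open import Data.Integer.Tactic.RingSolver using (solve-∀)
open import Data.Fin using (Fin; zero; suc)
import Data.Fin.Properties as Finₚ
open import Data.Fin.Subset using (Subset; _∈_; _∉_; _∪_; _⊆_)
open import Data.Fin.Subset.Properties using (_∈?_; x∈⁅x⁆; x∈⁅y⁆⇒x≡y; x≢y⇒x∉⁅y⁆; p⊆p∪q; q⊆p∪q; x∈p∪q⁻)
open import Data.List using (List; []; _∷_; length; map; _++_; allFin)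
open import Data.List.Properties using (length-map; length-++; length-tabulate)
open import Data.List.Relation.Unary.All using (All; []; _∷_)
import Data.List.Relation.Unary.All as All
import Data.List.Relation.Unary.All.Properties as Allₚ
open import Data.List.Relation.Unary.AllPairs using (AllPairs; []; _∷_)
import Data.List.Relation.Unary.AllPairs.Properties as AllPairsₚ
open import Data.List.Membership.Propositional using () renaming (_∈_ to _∈ˡ_)
open import Data.List.Membership.Propositional.Properties using (∈-map⁺; ∈-++⁺ˡ; ∈-++⁺ʳ; ∈-allFin)
open import Data.Vec using (Vec; []; _∷_; zipWith; replicate; lookup; tabulate)
open import Data.Vec.Properties using (lookup∘tabulate; tabulate∘lookup; tabulate-cong; lookup-zipWith; ∷-injective)
open import Data.Product using (Σ; _×_; _,_; proj₁; proj₂)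
open import Data.Sum using (_⊎_; inj₁; inj₂; [_,_]′)
open import Data.Empty using (⊥-elim)
open import Function using (_∘_)
open import Relation.Nullary using (yes; no)
open import Relation.Binary.PropositionalEquality using (_≡_; _≢_; refl; sym; trans; cong; cong₂; subst; module ≡-Reasoning)

-- Integer linear algebra

𝟎 : ∀ {n} → Vec ℤ n
𝟎 = replicate _ 0ℤ

-- The single vector operation of the development: with it, linearity is one equation, and scaling
-- is the instance with second coefficient zero.
combine : ∀ {n} → ℤ → Vec ℤ n → ℤ → Vec ℤ n → Vec ℤ n
combine a u b v = zipWith (λ x y → a * x + b * y) u v

Linear : ∀ {n} → (Vec ℤ n → ℤ) → Set
Linear f = ∀ a u b v → f (combine a u b v) ≡ a * f u + b * f v

LinearMap : ∀ {m n} → (Vec ℤ m → Vec ℤ n) → Set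
LinearMap F = ∀ a u b v → F (combine a u b v) ≡ combine a (F u) b (F v)

vec-ext : ∀ {n} {u v : Vec ℤ n} → (∀ p → lookup u p ≡ lookup v p) → u ≡ v
vec-ext {u = u} {v} eq = begin
  u                    ≡⟨ tabulate∘lookup u ⟨
  tabulate (lookup u)  ≡⟨ tabulate-cong eq ⟩
  tabulate (lookup v)  ≡⟨ tabulate∘lookup v ⟩
  v                    ∎
  where open ≡-Reasoning

combine-𝟎 : ∀ {n} a b → combine a (𝟎 {n}) b 𝟎 ≡ 𝟎
combine-𝟎 {zero}  a b = refl
combine-𝟎 {suc n} a b = cong₂ _∷_ (lemma a b) (combine-𝟎 a b)
  where
  lemma : ∀ a b → a * 0ℤ + b * 0ℤ ≡ 0ℤ
  lemma = solve-∀

combine-0-1 : ∀ {n} (v : Vec ℤ n) a → combine a 𝟎 1ℤ v ≡ v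
combine-0-1 []      a = refl
combine-0-1 (x ∷ v) a = cong₂ _∷_ (lemma x a) (combine-0-1 v a)
  where
  lemma : ∀ x a → a * 0ℤ + 1ℤ * x ≡ x
  lemma = solve-∀

combine-∷ : ∀ {n} x (v : Vec ℤ n) → combine x (1ℤ ∷ 𝟎) 1ℤ (0ℤ ∷ v) ≡ x ∷ v
combine-∷ x v = cong₂ _∷_ (lemma x) (combine-0-1 v x)
  where
  lemma : ∀ x → x * 1ℤ + 1ℤ * 0ℤ ≡ x
  lemma = solve-∀

scale : ∀ {n} → ℤ → Vec ℤ n → Vec ℤ n
scale c v = combine c v 0ℤ v

scale-linear : ∀ {n} c → LinearMap (scale {n} c)
scale-linear c a []      b []      = refl
scale-linear c a (x ∷ u) b (y ∷ v) = cong₂ _∷_ (lemma a b c x y) (scale-linear c a u b v)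
  where
  lemma : ∀ a b c x y → c * (a * x + b * y) + 0ℤ * (a * x + b * y) ≡ a * (c * x + 0ℤ * x) + b * (c * y + 0ℤ * y)
  lemma = solve-∀

scale-injective : ∀ {n c} → c ≢ 0ℤ → (v : Vec ℤ n) → scale c v ≡ 𝟎 → v ≡ 𝟎
scale-injective c≢0 []      _  = refl
scale-injective {c = c} c≢0 (x ∷ v) eq with ∷-injective eq
... | cx≡0 , cv≡0 with ℤₚ.i*j≡0⇒i≡0∨j≡0 c (trans (lemma c x) cx≡0)
  where
  lemma : ∀ c x → c * x ≡ c * x + 0ℤ * x
  lemma = solve-∀
... | inj₁ c≡0 = ⊥-elim (c≢0 c≡0)
... | inj₂ x≡0 = cong₂ _∷_ x≡0 (scale-injective c≢0 v cv≡0)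

tail-linear : ∀ {n} {f : Vec ℤ (suc n) → ℤ} → Linear f → Linear (f ∘ (0ℤ ∷_))
tail-linear {f = f} f-lin a u b v = begin
  f (0ℤ ∷ combine a u b v)               ≡⟨ cong (λ x → f (x ∷ combine a u b v)) (lemma a b) ⟩
  f (combine a (0ℤ ∷ u) b (0ℤ ∷ v))      ≡⟨ f-lin a (0ℤ ∷ u) b (0ℤ ∷ v) ⟩
  a * f (0ℤ ∷ u) + b * f (0ℤ ∷ v)        ∎
  where
  open ≡-Reasoning
  lemma : ∀ a b → 0ℤ ≡ a * 0ℤ + b * 0ℤ
  lemma = solve-∀

expand-head : ∀ {n} {f : Vec ℤ (suc n) → ℤ} → Linear f →
              ∀ x v → f (x ∷ v) ≡ x * f (1ℤ ∷ 𝟎) + f (0ℤ ∷ v)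
expand-head {f = f} f-lin x v = begin
  f (x ∷ v)                                  ≡⟨ cong f (combine-∷ x v) ⟨
  f (combine x (1ℤ ∷ 𝟎) 1ℤ (0ℤ ∷ v))         ≡⟨ f-lin x (1ℤ ∷ 𝟎) 1ℤ (0ℤ ∷ v) ⟩
  x * f (1ℤ ∷ 𝟎) + 1ℤ * f (0ℤ ∷ v)           ≡⟨ cong (λ y → x * f (1ℤ ∷ 𝟎) + y) (ℤₚ.*-identityˡ (f (0ℤ ∷ v))) ⟩
  x * f (1ℤ ∷ 𝟎) + f (0ℤ ∷ v)                ∎
  where open ≡-Reasoning

-- A division-free form of "the kernel of one functional has corank at most one": `ℤᵐ` embeds
-- linearly into the kernel of a functional on `ℤᵐ⁺¹`.
record KernelEmbedding {m} (f : Vec ℤ (suc m) → ℤ) : Set where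
  field
    embed     : Vec ℤ m → Vec ℤ (suc m)
    linear    : LinearMap embed
    injective : ∀ v → embed v ≡ 𝟎 → v ≡ 𝟎
    in-kernel : ∀ v → f (embed v) ≡ 0ℤ

-- Let `c` be the value of `f` on the first basis vector. If `c` is nonzero, solve for the first
-- coordinate and multiply through by `c` to clear the denominator. If `c` is zero, the first
-- coordinate is free and the tail is treated recursively.
kernelEmbedding : ∀ {m} (f : Vec ℤ (suc m) → ℤ) → Linear f → KernelEmbedding f
kernelEmbedding {m} f f-lin with f (1ℤ ∷ 𝟎) ≟ 0ℤ
kernelEmbedding {m} f f-lin | no c≢0 = record
  { embed     = λ v → (- f (0ℤ ∷ v)) ∷ scale c v
  ; linear    = λ a u b v → cong₂ _∷_
      (trans (cong -_ (tail-linear f-lin a u b v)) (neg-lin a b (f (0ℤ ∷ u)) (f (0ℤ ∷ v))))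
      (scale-linear c a u b v)
  ; injective = λ v eq → scale-injective c≢0 v (proj₂ (∷-injective eq))
  ; in-kernel = λ v → begin
      f ((- f (0ℤ ∷ v)) ∷ scale c v)                           ≡⟨ expand-head f-lin (- f (0ℤ ∷ v)) (scale c v) ⟩
      (- f (0ℤ ∷ v)) * c + f (0ℤ ∷ scale c v)                  ≡⟨ cong (λ y → (- f (0ℤ ∷ v)) * c + y) (tail-linear f-lin c v 0ℤ v) ⟩
      (- f (0ℤ ∷ v)) * c + (c * f (0ℤ ∷ v) + 0ℤ * f (0ℤ ∷ v))  ≡⟨ cancel c (f (0ℤ ∷ v)) ⟩
      0ℤ                                                       ∎
  }
  where
  open ≡-Reasoning
  c = f (1ℤ ∷ 𝟎)
  neg-lin : ∀ a b x y → - (a * x + b * y) ≡ a * - x + b * - y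
  neg-lin = solve-∀
  cancel : ∀ c x → (- x) * c + (c * x + 0ℤ * x) ≡ 0ℤ
  cancel = solve-∀
kernelEmbedding {zero} f f-lin | yes c≡0 = record
  { embed     = λ _ → 𝟎
  ; linear    = λ a _ b _ → sym (combine-𝟎 a b)
  ; injective = λ { [] _ → refl }
  ; in-kernel = λ _ → begin
      f (0ℤ ∷ [])                      ≡⟨ cong f (combine-𝟎 {1} 0ℤ 0ℤ) ⟨
      f (combine 0ℤ 𝟎 0ℤ 𝟎)            ≡⟨ f-lin 0ℤ 𝟎 0ℤ 𝟎 ⟩
      0ℤ * f 𝟎 + 0ℤ * f 𝟎              ≡⟨ lemma (f 𝟎) ⟩
      0ℤ                               ∎
  }
  where
  open ≡-Reasoning
  lemma : ∀ x → 0ℤ * x + 0ℤ * x ≡ 0ℤ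
  lemma = solve-∀
kernelEmbedding {suc m} f f-lin | yes c≡0 = record
  { embed     = embed
  ; linear    = λ { a (x ∷ u) b (y ∷ v) → cong (_ ∷_) (K.linear a u b v) }
  ; injective = λ { (x ∷ v) eq → cong₂ _∷_ (proj₁ (∷-injective eq)) (K.injective v (proj₂ (∷-injective eq))) }
  ; in-kernel = λ { (x ∷ v) → begin
      f (x ∷ K.embed v)                       ≡⟨ expand-head f-lin x (K.embed v) ⟩
      x * f (1ℤ ∷ 𝟎) + f (0ℤ ∷ K.embed v)     ≡⟨ cong₂ (λ c d → x * c + d) c≡0 (K.in-kernel v) ⟩
      x * 0ℤ + 0ℤ                             ≡⟨ lemma x ⟩
      0ℤ                                      ∎ }
  }
  where
  open ≡-Reasoning
  module K = KernelEmbedding (kernelEmbedding (f ∘ (0ℤ ∷_)) (tail-linear f-lin))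
  embed : Vec ℤ (suc m) → Vec ℤ (suc (suc m))
  embed (x ∷ v) = x ∷ K.embed v
  lemma : ∀ x → x * 0ℤ + 0ℤ ≡ 0ℤ
  lemma = solve-∀

-- Restricting to the kernel of the first functional uses up one functional and at most one
-- dimension, and joint injectivity survives because the kernel is embedded injectively.
dimension≤functionals : ∀ m (fs : List (Vec ℤ m → ℤ)) → All Linear fs →
  (∀ v → All (λ f → f v ≡ 0ℤ) fs → v ≡ 𝟎) → m ≤ length fs
dimension≤functionals zero    fs       _               _     = z≤n
-- With no functionals left, joint injectivity would make a basis vector zero.
dimension≤functionals (suc m) []       _               joint with joint (1ℤ ∷ 𝟎) []
... | ()
dimension≤functionals (suc m) (f ∷ fs) (f-lin ∷ fs-lin) joint =
  s≤s (subst (m ≤_) (length-map (_∘ K.embed) fs)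
    (dimension≤functionals m (map (_∘ K.embed) fs)
      (Allₚ.map⁺ (All.map restrict-linear fs-lin))
      (λ v zeros → K.injective v (joint (K.embed v) (K.in-kernel v ∷ Allₚ.map⁻ zeros)))))
  where
  module K = KernelEmbedding (kernelEmbedding f f-lin)
  restrict-linear : ∀ {g} → Linear g → Linear (g ∘ K.embed)
  restrict-linear {g} g-lin a u b v =
    trans (cong g (K.linear a u b v)) (g-lin a (K.embed u) b (K.embed v))

-- Unit vectors and alternating forms

e : ∀ {n} → Fin n → Vec ℤ n
e zero    = 1ℤ ∷ 𝟎
e (suc p) = 0ℤ ∷ e p

lookup-𝟎 : ∀ {n} (p : Fin n) → lookup 𝟎 p ≡ 0ℤ
lookup-𝟎 zero    = refl
lookup-𝟎 (suc p) = lookup-𝟎 p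

lookup-e-≡ : ∀ {n} (p : Fin n) → lookup (e p) p ≡ 1ℤ
lookup-e-≡ zero    = refl
lookup-e-≡ (suc p) = lookup-e-≡ p

lookup-e-≢ : ∀ {n} {p q : Fin n} → p ≢ q → lookup (e p) q ≡ 0ℤ
lookup-e-≢ {p = zero}  {zero}  p≢q = ⊥-elim (p≢q refl)
lookup-e-≢ {p = zero}  {suc q} p≢q = lookup-𝟎 q
lookup-e-≢ {p = suc p} {zero}  p≢q = refl
lookup-e-≢ {p = suc p} {suc q} p≢q = lookup-e-≢ (p≢q ∘ cong suc)

vanishing-on-basis : ∀ {n} {f : Vec ℤ n → ℤ} → Linear f → (∀ p → f (e p) ≡ 0ℤ) → ∀ v → f v ≡ 0ℤ
vanishing-on-basis {f = f} f-lin f-e [] =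
  trans (f-lin 0ℤ [] 0ℤ []) (lemma (f []))
  where
  lemma : ∀ x → 0ℤ * x + 0ℤ * x ≡ 0ℤ
  lemma = solve-∀
vanishing-on-basis {f = f} f-lin f-e (x ∷ v) = begin
  f (x ∷ v)                        ≡⟨ expand-head f-lin x v ⟩
  x * f (1ℤ ∷ 𝟎) + f (0ℤ ∷ v)      ≡⟨ cong₂ (λ c d → x * c + d) (f-e zero)
                                        (vanishing-on-basis (tail-linear f-lin) (f-e ∘ suc) v) ⟩
  x * 0ℤ + 0ℤ                      ≡⟨ lemma x ⟩
  0ℤ                               ∎
  where
  open ≡-Reasoning
  lemma : ∀ x → x * 0ℤ + 0ℤ ≡ 0ℤ
  lemma = solve-∀

record IsAlternating {n} (B : Vec ℤ n → Vec ℤ n → ℤ) : Set where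
  field
    linearˡ       : ∀ v → Linear (λ u → B u v)
    antisymmetric : ∀ u v → B u v ≡ - B v u

  linearʳ : ∀ u → Linear (B u)
  linearʳ u a v b w = begin
    B u (combine a v b w)        ≡⟨ antisymmetric u (combine a v b w) ⟩
    - B (combine a v b w) u      ≡⟨ cong -_ (linearˡ u a v b w) ⟩
    - (a * B v u + b * B w u)    ≡⟨ lemma a b (B v u) (B w u) ⟩
    a * - B v u + b * - B w u    ≡⟨ cong₂ (λ x y → a * x + b * y) (antisymmetric u v) (antisymmetric u w) ⟨
    a * B u v + b * B u w        ∎
    where
    open ≡-Reasoning
    lemma : ∀ a b x y → - (a * x + b * y) ≡ a * - x + b * - y
    lemma = solve-∀

  isotropic : ∀ u → B u u ≡ 0ℤ
  isotropic u = self-opposite (B u u) (antisymmetric u u)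
    where
    self-opposite : ∀ x → x ≡ - x → x ≡ 0ℤ
    -- For every nonzero integer, `x` and `- x` have different constructors, so coverage leaves only
    -- zero.
    self-opposite (+ zero) _ = refl

-- The pairs with `p` below `q`: positions of the strictly upper triangular entries of an
-- alternating matrix.
pairs : ∀ n → List (Fin n × Fin n)
pairs zero    = []
pairs (suc n) = map (λ q → zero , suc q) (allFin n) ++ map (λ (p , q) → suc p , suc q) (pairs n)

-- Pascal's rule, with `n` read as `n C 1`. It counts the pairs here and adds up the rounds of calls
-- in the lower bound.
pascal : ∀ n → n ℕ.+ n C 2 ≡ suc n C 2
pascal n = trans (cong (ℕ._+ n C 2) (sym (nC1≡n n))) (nCk+nC[k+1]≡[n+1]C[k+1] n 1)

length-allFin : ∀ n → length (allFin n) ≡ n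
length-allFin n = length-tabulate {n = n} (λ i → i)

length-pairs : ∀ n → length (pairs n) ≡ n C 2
length-pairs zero    = refl
length-pairs (suc n) = begin
  length (pairs (suc n))                               ≡⟨ length-++ (map _ (allFin n)) ⟩
  length (map (λ q → zero , suc q) (allFin n)) ℕ.+ length (map sucs (pairs n))
    ≡⟨ cong₂ ℕ._+_ (trans (length-map _ (allFin n)) (length-allFin n))
                   (trans (length-map sucs (pairs n)) (length-pairs n)) ⟩
  n ℕ.+ n C 2                                          ≡⟨ pascal n ⟩
  suc n C 2                                            ∎
  where
  open ≡-Reasoning
  sucs : Fin n × Fin n → Fin (suc n) × Fin (suc n)
  sucs (p , q) = suc p , suc q

pairs-complete : ∀ {n} (p q : Fin n) → (p , q) ∈ˡ pairs n ⊎ p ≡ q ⊎ (q , p) ∈ˡ pairs n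
pairs-complete zero    zero    = inj₂ (inj₁ refl)
pairs-complete zero    (suc q) = inj₁ (∈-++⁺ˡ (∈-map⁺ _ (∈-allFin q)))
pairs-complete (suc p) zero    = inj₂ (inj₂ (∈-++⁺ˡ (∈-map⁺ _ (∈-allFin p))))
pairs-complete (suc p) (suc q) with pairs-complete p q
... | inj₁ pq        = inj₁ (∈-++⁺ʳ _ (∈-map⁺ _ pq))
... | inj₂ (inj₁ eq) = inj₂ (inj₁ (cong suc eq))
... | inj₂ (inj₂ qp) = inj₂ (inj₂ (∈-++⁺ʳ _ (∈-map⁺ _ qp)))

-- The entries above the diagonal determine the matrix: isotropy handles the diagonal, antisymmetry
-- the entries below it, and bilinearity all other arguments.
vanishing-on-pairs : ∀ {n} {B : Vec ℤ n → Vec ℤ n → ℤ} → IsAlternating B →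
  All (λ (p , q) → B (e p) (e q) ≡ 0ℤ) (pairs n) → ∀ u v → B u v ≡ 0ℤ
vanishing-on-pairs {B = B} B-alt zeros u v =
  vanishing-on-basis (linearˡ v) (λ p → vanishing-on-basis (linearʳ (e p)) (on-basis p) v) u
  where
  open IsAlternating B-alt
  on-basis : ∀ p q → B (e p) (e q) ≡ 0ℤ
  on-basis p q with pairs-complete p q
  ... | inj₁ pq          = All.lookup zeros pq
  ... | inj₂ (inj₁ refl) = isotropic (e p)
  ... | inj₂ (inj₂ qp)   = trans (antisymmetric (e p) (e q)) (cong -_ (All.lookup zeros qp))

-- The action of 2 × 2 matrices on two coordinates

module _ {n} (i j : Fin n) (a b c d : ℤ) where

  actAt : Vec ℤ n → Fin n → ℤ
  actAt u k with k Finₚ.≟ i | k Finₚ.≟ j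
  ... | yes _ | _     = a * lookup u i + b * lookup u j
  ... | no _  | yes _ = c * lookup u i + d * lookup u j
  ... | no _  | no _  = lookup u k

  act : Vec ℤ n → Vec ℤ n
  act u = tabulate (actAt u)

  act-i : ∀ u → lookup (act u) i ≡ a * lookup u i + b * lookup u j
  act-i u = trans (lookup∘tabulate (actAt u) i) lemma
    where
    lemma : actAt u i ≡ a * lookup u i + b * lookup u j
    lemma with i Finₚ.≟ i
    ... | yes _  = refl
    ... | no i≢i = ⊥-elim (i≢i refl)

  act-j : i ≢ j → ∀ u → lookup (act u) j ≡ c * lookup u i + d * lookup u j
  act-j i≢j u = trans (lookup∘tabulate (actAt u) j) lemma
    where
    lemma : actAt u j ≡ c * lookup u i + d * lookup u j
    lemma with j Finₚ.≟ i | j Finₚ.≟ j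
    ... | yes j≡i | _      = ⊥-elim (i≢j (sym j≡i))
    ... | no _    | yes _  = refl
    ... | no _    | no j≢j = ⊥-elim (j≢j refl)

  act-other : ∀ {k} → k ≢ i → k ≢ j → ∀ u → lookup (act u) k ≡ lookup u k
  act-other {k} k≢i k≢j u = trans (lookup∘tabulate (actAt u) k) lemma
    where
    lemma : actAt u k ≡ lookup u k
    lemma with k Finₚ.≟ i | k Finₚ.≟ j
    ... | yes k≡i | _       = ⊥-elim (k≢i k≡i)
    ... | no _    | yes k≡j = ⊥-elim (k≢j k≡j)
    ... | no _    | no _    = refl

coordinates : ∀ {n} (i j : Fin n) {P : Fin n → Set} → P i → P j →
              (∀ {k} → k ≢ i → k ≢ j → P k) → ∀ k → P k
coordinates i j Pi Pj Pk k with k Finₚ.≟ i | k Finₚ.≟ j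
... | yes refl | _        = Pi
... | no _     | yes refl = Pj
... | no k≢i   | no k≢j   = Pk k≢i k≢j

act-linear : ∀ {n} {i j : Fin n} → i ≢ j → ∀ a b c d → LinearMap (act i j a b c d)
act-linear {n} {i} {j} i≢j a b c d s u t v = vec-ext (coordinates i j
  (begin
    lookup (A (combine s u t v)) i                          ≡⟨ act-i i j a b c d (combine s u t v) ⟩
    a * lookup (combine s u t v) i + b * lookup (combine s u t v) j
      ≡⟨ cong₂ (λ x y → a * x + b * y) (entry u v i) (entry u v j) ⟩
    a * (s * lookup u i + t * lookup v i) + b * (s * lookup u j + t * lookup v j)
      ≡⟨ interchange a b s t (lookup u i) (lookup u j) (lookup v i) (lookup v j) ⟩
    s * (a * lookup u i + b * lookup u j) + t * (a * lookup v i + b * lookup v j)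
      ≡⟨ cong₂ (λ x y → s * x + t * y) (act-i i j a b c d u) (act-i i j a b c d v) ⟨
    s * lookup (A u) i + t * lookup (A v) i                 ≡⟨ entry (A u) (A v) i ⟨
    lookup (combine s (A u) t (A v)) i                      ∎)
  (begin
    lookup (A (combine s u t v)) j                          ≡⟨ act-j i j a b c d i≢j (combine s u t v) ⟩
    c * lookup (combine s u t v) i + d * lookup (combine s u t v) j
      ≡⟨ cong₂ (λ x y → c * x + d * y) (entry u v i) (entry u v j) ⟩
    c * (s * lookup u i + t * lookup v i) + d * (s * lookup u j + t * lookup v j)
      ≡⟨ interchange c d s t (lookup u i) (lookup u j) (lookup v i) (lookup v j) ⟩
    s * (c * lookup u i + d * lookup u j) + t * (c * lookup v i + d * lookup v j)
      ≡⟨ cong₂ (λ x y → s * x + t * y) (act-j i j a b c d i≢j u) (act-j i j a b c d i≢j v) ⟨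
    s * lookup (A u) j + t * lookup (A v) j                 ≡⟨ entry (A u) (A v) j ⟨
    lookup (combine s (A u) t (A v)) j                      ∎)
  (λ {k} k≢i k≢j → begin
    lookup (A (combine s u t v)) k                          ≡⟨ act-other i j a b c d k≢i k≢j (combine s u t v) ⟩
    lookup (combine s u t v) k                              ≡⟨ entry u v k ⟩
    s * lookup u k + t * lookup v k
      ≡⟨ cong₂ (λ x y → s * x + t * y) (act-other i j a b c d k≢i k≢j u) (act-other i j a b c d k≢i k≢j v) ⟨
    s * lookup (A u) k + t * lookup (A v) k                 ≡⟨ entry (A u) (A v) k ⟨
    lookup (combine s (A u) t (A v)) k                      ∎))
  where
  open ≡-Reasoning
  A = act i j a b c d
  entry : ∀ u v k → lookup (combine s u t v) k ≡ s * lookup u k + t * lookup v k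
  entry u v k = lookup-zipWith (λ x y → s * x + t * y) k u v
  interchange : ∀ a b s t x y z w →
    a * (s * x + t * z) + b * (s * y + t * w) ≡ s * (a * x + b * y) + t * (a * z + b * w)
  interchange = solve-∀

2ℤ : ℤ
2ℤ = + 2

module Exchange {n} {i j : Fin n} (i≢j : i ≢ j) where

  -- `T` has determinant 1, so its inverse `R` is again integral and `T` preserves the 2 × 2 minors
  -- in the coordinates `i` and `j`.
  T R : Vec ℤ n → Vec ℤ n
  T = act i j 1ℤ 1ℤ 1ℤ 2ℤ
  R = act i j 2ℤ -1ℤ -1ℤ 1ℤ

  T-i : ∀ u → lookup (T u) i ≡ 1ℤ * lookup u i + 1ℤ * lookup u j
  T-i = act-i i j 1ℤ 1ℤ 1ℤ 2ℤ

  T-j : ∀ u → lookup (T u) j ≡ 1ℤ * lookup u i + 2ℤ * lookup u j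
  T-j = act-j i j 1ℤ 1ℤ 1ℤ 2ℤ i≢j

  T-other : ∀ {k} → k ≢ i → k ≢ j → ∀ u → lookup (T u) k ≡ lookup u k
  T-other = act-other i j 1ℤ 1ℤ 1ℤ 2ℤ

  R-i : ∀ u → lookup (R u) i ≡ 2ℤ * lookup u i + -1ℤ * lookup u j
  R-i = act-i i j 2ℤ -1ℤ -1ℤ 1ℤ

  R-j : ∀ u → lookup (R u) j ≡ -1ℤ * lookup u i + 1ℤ * lookup u j
  R-j = act-j i j 2ℤ -1ℤ -1ℤ 1ℤ i≢j

  R-other : ∀ {k} → k ≢ i → k ≢ j → ∀ u → lookup (R u) k ≡ lookup u k
  R-other = act-other i j 2ℤ -1ℤ -1ℤ 1ℤ

  R-linear : LinearMap R
  R-linear = act-linear i≢j 2ℤ -1ℤ -1ℤ 1ℤ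

  R∘T : ∀ u → R (T u) ≡ u
  R∘T u = vec-ext (coordinates i j
    (trans (R-i (T u)) (trans (cong₂ (λ x y → 2ℤ * x + -1ℤ * y) (T-i u) (T-j u)) (at-i (lookup u i) (lookup u j))))
    (trans (R-j (T u)) (trans (cong₂ (λ x y → -1ℤ * x + 1ℤ * y) (T-i u) (T-j u)) (at-j (lookup u i) (lookup u j))))
    (λ k≢i k≢j → trans (R-other k≢i k≢j (T u)) (T-other k≢i k≢j u)))
    where
    at-i : ∀ x y → 2ℤ * (1ℤ * x + 1ℤ * y) + -1ℤ * (1ℤ * x + 2ℤ * y) ≡ x
    at-i = solve-∀
    at-j : ∀ x y → -1ℤ * (1ℤ * x + 1ℤ * y) + 1ℤ * (1ℤ * x + 2ℤ * y) ≡ y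
    at-j = solve-∀

  private
    entry : ∀ a b k → lookup (combine a (e i) b (e j)) k ≡ a * lookup (e i) k + b * lookup (e j) k
    entry a b k = lookup-zipWith (λ x y → a * x + b * y) k (e i) (e j)

    j≢i : j ≢ i
    j≢i = i≢j ∘ sym

    entry-i : ∀ a b → lookup (combine a (e i) b (e j)) i ≡ a * 1ℤ + b * 0ℤ
    entry-i a b = trans (entry a b i) (cong₂ (λ x y → a * x + b * y) (lookup-e-≡ i) (lookup-e-≢ j≢i))

    entry-j : ∀ a b → lookup (combine a (e i) b (e j)) j ≡ a * 0ℤ + b * 1ℤ
    entry-j a b = trans (entry a b j) (cong₂ (λ x y → a * x + b * y) (lookup-e-≢ i≢j) (lookup-e-≡ j))

    entry-other : ∀ a b {k} → k ≢ i → k ≢ j → lookup (combine a (e i) b (e j)) k ≡ 0ℤ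
    entry-other a b {k} k≢i k≢j = trans (entry a b k)
      (trans (cong₂ (λ x y → a * x + b * y) (lookup-e-≢ (k≢i ∘ sym)) (lookup-e-≢ (k≢j ∘ sym))) (lemma a b))
      where
      lemma : ∀ a b → a * 0ℤ + b * 0ℤ ≡ 0ℤ
      lemma = solve-∀

  -- The columns of `R`. What matters later is that `R` keeps the span of `e i` and `e j` and fixes
  -- every other basis vector.
  R-e-i : R (e i) ≡ combine 2ℤ (e i) -1ℤ (e j)
  R-e-i = vec-ext (coordinates i j
    (trans (R-i (e i)) (trans (cong₂ (λ x y → 2ℤ * x + -1ℤ * y) (lookup-e-≡ i) (lookup-e-≢ i≢j)) (sym (entry-i 2ℤ -1ℤ))))
    (trans (R-j (e i)) (trans (cong₂ (λ x y → -1ℤ * x + 1ℤ * y) (lookup-e-≡ i) (lookup-e-≢ i≢j)) (sym (entry-j 2ℤ -1ℤ))))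
    (λ k≢i k≢j → trans (R-other k≢i k≢j (e i))
      (trans (lookup-e-≢ (k≢i ∘ sym)) (sym (entry-other 2ℤ -1ℤ k≢i k≢j)))))

  R-e-j : R (e j) ≡ combine -1ℤ (e i) 1ℤ (e j)
  R-e-j = vec-ext (coordinates i j
    (trans (R-i (e j)) (trans (cong₂ (λ x y → 2ℤ * x + -1ℤ * y) (lookup-e-≢ j≢i) (lookup-e-≡ j)) (sym (entry-i -1ℤ 1ℤ))))
    (trans (R-j (e j)) (trans (cong₂ (λ x y → -1ℤ * x + 1ℤ * y) (lookup-e-≢ j≢i) (lookup-e-≡ j)) (sym (entry-j -1ℤ 1ℤ))))
    (λ k≢i k≢j → trans (R-other k≢i k≢j (e j))
      (trans (lookup-e-≢ (k≢j ∘ sym)) (sym (entry-other -1ℤ 1ℤ k≢i k≢j)))))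

  R-e-other : ∀ {k} → k ≢ i → k ≢ j → R (e k) ≡ e k
  R-e-other {k} k≢i k≢j = vec-ext (coordinates i j
    (trans (R-i (e k)) (trans (cong₂ (λ x y → 2ℤ * x + -1ℤ * y) (lookup-e-≢ k≢i) (lookup-e-≢ k≢j)) (sym (lookup-e-≢ k≢i))))
    (trans (R-j (e k)) (trans (cong₂ (λ x y → -1ℤ * x + 1ℤ * y) (lookup-e-≢ k≢i) (lookup-e-≢ k≢j)) (sym (lookup-e-≢ k≢j))))
    (λ l≢i l≢j → R-other l≢i l≢j (e k)))

-- States after a call

module _ {n} {i j : Fin n} (i≢j : i ≢ j) (s : State n) where

  applyCall-i : applyCall (i , j , i≢j) s i ≡ s i ∪ s j
  applyCall-i with i Finₚ.≟ i | i Finₚ.≟ j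
  ... | yes _  | _ = refl
  ... | no i≢i | _ = ⊥-elim (i≢i refl)

  applyCall-j : applyCall (i , j , i≢j) s j ≡ s i ∪ s j
  applyCall-j with j Finₚ.≟ i | j Finₚ.≟ j
  ... | yes _ | _      = refl
  ... | no _  | yes _  = refl
  ... | no _  | no j≢j = ⊥-elim (j≢j refl)

  applyCall-other : ∀ {k} → k ≢ i → k ≢ j → applyCall (i , j , i≢j) s k ≡ s k
  applyCall-other {k} k≢i k≢j with k Finₚ.≟ i | k Finₚ.≟ j
  ... | yes k≡i | _       = ⊥-elim (k≢i k≡i)
  ... | no _    | yes k≡j = ⊥-elim (k≢j k≡j)
  ... | no _    | no _    = refl

-- Positive weights for known pieces

∉-∪ˡ : ∀ {n} {x : Fin n} (p q : Subset n) → x ∉ p ∪ q → x ∉ p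
∉-∪ˡ p q x∉ = x∉ ∘ p⊆p∪q q

∉-∪ʳ : ∀ {n} {x : Fin n} (p q : Subset n) → x ∉ p ∪ q → x ∉ q
∉-∪ʳ p q x∉ = x∉ ∘ q⊆p∪q p q

-- Positivity, rather than mere nonvanishing, rules out cancellation when a call adds the weights of
-- its two participants.
record Weights {n} (s : State n) (y : Fin n → Vec ℤ n) : Set where
  field
    known   : ∀ {x} p → x ∈ s p → 0ℤ < lookup (y x) p
    unknown : ∀ {x} p → x ∉ s p → lookup (y x) p ≡ 0ℤ

  nonnegative : ∀ x p → 0ℤ ℤ.≤ lookup (y x) p
  nonnegative x p with x ∈? s p
  ... | yes x∈ = ℤₚ.<⇒≤ (known p x∈)
  ... | no  x∉ = ℤₚ.≤-reflexive (sym (unknown p x∉))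

initial-weights : ∀ {n} → Weights (initial n) e
initial-weights = record
  { known   = λ p x∈ → subst (λ x → 0ℤ < lookup (e x) p) (sym (x∈⁅y⁆⇒x≡y p x∈))
                         (subst (0ℤ <_) (sym (lookup-e-≡ p)) (+<+ (s≤s z≤n)))
  ; unknown = λ {x} p x∉ → lookup-e-≢ {p = x} {p} (λ { refl → x∉ (x∈⁅x⁆ p) })
  }

module _ {n} {i j : Fin n} (i≢j : i ≢ j) {s : State n} {y : Fin n → Vec ℤ n} (w : Weights s y) where
  open Exchange i≢j
  open Weights w

  private
    s′ = applyCall (i , j , i≢j) s

    positive-sum : ∀ {a b} → 0ℤ ℤ.≤ a → 0ℤ ℤ.≤ b → 0ℤ < a ⊎ 0ℤ < b → 0ℤ < a + b
    positive-sum _   0≤b (inj₁ 0<a) = ℤₚ.+-mono-<-≤ 0<a 0≤b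
    positive-sum 0≤a _   (inj₂ 0<b) = ℤₚ.+-mono-≤-< 0≤a 0<b

    positive-i : ∀ {a b} → 0ℤ ℤ.≤ a → 0ℤ ℤ.≤ b → 0ℤ < a ⊎ 0ℤ < b → 0ℤ < 1ℤ * a + 1ℤ * b
    positive-i {a} {b} 0≤a 0≤b h = subst (0ℤ <_) (lemma a b) (positive-sum 0≤a 0≤b h)
      where
      lemma : ∀ a b → a + b ≡ 1ℤ * a + 1ℤ * b
      lemma = solve-∀

    positive-j : ∀ {a b} → 0ℤ ℤ.≤ a → 0ℤ ℤ.≤ b → 0ℤ < a ⊎ 0ℤ < b → 0ℤ < 1ℤ * a + 2ℤ * b
    positive-j {a} {b} 0≤a 0≤b h = subst (0ℤ <_) (lemma a b) (ℤₚ.+-mono-<-≤ (positive-sum 0≤a 0≤b h) 0≤b)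
      where
      lemma : ∀ a b → (a + b) + b ≡ 1ℤ * a + 2ℤ * b
      lemma = solve-∀

    known-by-one : ∀ {x} → x ∈ s i ∪ s j → 0ℤ < lookup (y x) i ⊎ 0ℤ < lookup (y x) j
    known-by-one x∈ with x∈p∪q⁻ (s i) (s j) x∈
    ... | inj₁ x∈i = inj₁ (known i x∈i)
    ... | inj₂ x∈j = inj₂ (known j x∈j)

    known′ : ∀ x p → x ∈ s′ p → 0ℤ < lookup (T (y x)) p
    known′ x = coordinates i j
      (λ x∈ → subst (0ℤ <_) (sym (T-i (y x)))
        (positive-i (nonnegative x i) (nonnegative x j) (known-by-one (subst (x ∈_) (applyCall-i i≢j s) x∈))))
      (λ x∈ → subst (0ℤ <_) (sym (T-j (y x)))
        (positive-j (nonnegative x i) (nonnegative x j) (known-by-one (subst (x ∈_) (applyCall-j i≢j s) x∈))))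
      (λ {k} k≢i k≢j x∈ → subst (0ℤ <_) (sym (T-other k≢i k≢j (y x)))
        (known k (subst (x ∈_) (applyCall-other i≢j s k≢i k≢j) x∈)))

    unknown′ : ∀ x p → x ∉ s′ p → lookup (T (y x)) p ≡ 0ℤ
    unknown′ x = coordinates i j
      (λ x∉ → trans (T-i (y x)) (cong₂ (λ a b → 1ℤ * a + 1ℤ * b) (zero-i (outside-i x∉)) (zero-j (outside-i x∉))))
      (λ x∉ → trans (T-j (y x)) (cong₂ (λ a b → 1ℤ * a + 2ℤ * b) (zero-i (outside-j x∉)) (zero-j (outside-j x∉))))
      (λ {k} k≢i k≢j x∉ → trans (T-other k≢i k≢j (y x))
        (unknown k (subst (x ∉_) (applyCall-other i≢j s k≢i k≢j) x∉)))
      where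
      outside-i : x ∉ s′ i → x ∉ s i ∪ s j
      outside-i = subst (x ∉_) (applyCall-i i≢j s)
      outside-j : x ∉ s′ j → x ∉ s i ∪ s j
      outside-j = subst (x ∉_) (applyCall-j i≢j s)
      zero-i : x ∉ s i ∪ s j → lookup (y x) i ≡ 0ℤ
      zero-i x∉ = unknown i (∉-∪ˡ (s i) (s j) x∉)
      zero-j : x ∉ s i ∪ s j → lookup (y x) j ≡ 0ℤ
      zero-j x∉ = unknown j (∉-∪ʳ (s i) (s j) x∉)

  -- Old weights `a` and `b` at `i` and `j` become `a + b` and `a + 2b`. Since both are nonnegative,
  -- each new weight is positive as soon as one old weight is, and zero if both are.
  call-weights : Weights s′ (T ∘ y)
  call-weights = record { known = λ {x} → known′ x ; unknown = λ {x} → unknown′ x }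

-- Spaces of compatible forms

-- A space of forms of dimension `k` is encoded by a linear parametrization by `ℤᵏ` with trivial
-- kernel (`faithful`), so that raising the dimension means adding one parameter.
record CompatibleForms {n} (s : State n) (y : Fin n → Vec ℤ n) (k : ℕ) : Set where
  field
    form        : Vec ℤ k → Vec ℤ n → Vec ℤ n → ℤ
    alternating : ∀ c → IsAlternating (form c)
    linear      : ∀ u v → Linear (λ c → form c u v)
    compatible  : ∀ c {x} p → x ∉ s p → form c (y x) (e p) ≡ 0ℤ
    faithful    : ∀ c → (∀ u v → form c u v ≡ 0ℤ) → c ≡ 𝟎

-- The functionals reading off the entries at `pairs n` have only the zero parameter as common zero.
compatible-dimension : ∀ {n s y k} → CompatibleForms {n} s y k → k ≤ n C 2
compatible-dimension {n} {k = k} F = subst (k ≤_) (trans (length-map entry (pairs n)) (length-pairs n))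
  (dimension≤functionals k (map entry (pairs n))
    (Allₚ.map⁺ (All.universal (λ (p , q) → linear (e p) (e q)) (pairs n)))
    (λ c zeros → faithful c (vanishing-on-pairs (alternating c) (Allₚ.map⁻ zeros))))
  where
  open CompatibleForms F
  entry : Fin n × Fin n → Vec ℤ k → ℤ
  entry (p , q) c = form c (e p) (e q)

-- The zero space is enough to start from, as `k` only has to grow by one with each call.
initial-forms : ∀ {n} → CompatibleForms (initial n) e 0
initial-forms = record
  { form        = λ _ _ _ → 0ℤ
  ; alternating = λ _ → record { linearˡ = λ _ a _ b _ → lemma a b ; antisymmetric = λ _ _ → refl }
  ; linear      = λ _ _ a _ b _ → lemma a b
  ; compatible  = λ _ _ _ → refl
  ; faithful    = λ { [] _ → refl }
  }
  where
  lemma : ∀ a b → 0ℤ ≡ a * 0ℤ + b * 0ℤ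
  lemma = solve-∀

module _ {n} {i j : Fin n} (i≢j : i ≢ j) {s : State n} {y : Fin n → Vec ℤ n} (w : Weights s y)
         (informative : Informative s (i , j , i≢j)) {k} (F : CompatibleForms s y k) where
  open Exchange i≢j
  open Weights w
  open CompatibleForms F
  open ≡-Reasoning

  private
    s′ = applyCall (i , j , i≢j) s

    minor : Vec ℤ n → Vec ℤ n → ℤ
    minor u v = lookup u i * lookup v j - lookup u j * lookup v i

    -- Old forms are pulled back along `R`, so their values on the new weights `T (y x)` come from
    -- those on `y x`. The extra parameter `l` is the coefficient of the new form `minor`.
    form′ : Vec ℤ (suc k) → Vec ℤ n → Vec ℤ n → ℤ
    form′ (l ∷ c) u v = form c (R u) (R v) + l * minor u v

    linearˡ′ : ∀ c v → Linear (λ u → form′ c u v)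
    linearˡ′ (l ∷ c) v a t b u = begin
      form c (R (combine a t b u)) (R v) + l * minor (combine a t b u) v
        ≡⟨ cong₂ (λ x z → x + l * z)
             (trans (cong (λ r → form c r (R v)) (R-linear a t b u))
                    (IsAlternating.linearˡ (alternating c) (R v) a (R t) b (R u)))
             (cong₂ (λ x z → x * lookup v j - z * lookup v i)
                    (lookup-zipWith (λ x z → a * x + b * z) i t u)
                    (lookup-zipWith (λ x z → a * x + b * z) j t u)) ⟩
      (a * form c (R t) (R v) + b * form c (R u) (R v))
        + l * ((a * lookup t i + b * lookup u i) * lookup v j - (a * lookup t j + b * lookup u j) * lookup v i)
        ≡⟨ lemma a b l (form c (R t) (R v)) (form c (R u) (R v))
                 (lookup t i) (lookup t j) (lookup u i) (lookup u j) (lookup v i) (lookup v j) ⟩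
      a * form′ (l ∷ c) t v + b * form′ (l ∷ c) u v ∎
      where
      lemma : ∀ a b l X Y ti tj ui uj vi vj →
        (a * X + b * Y) + l * ((a * ti + b * ui) * vj - (a * tj + b * uj) * vi)
          ≡ a * (X + l * (ti * vj - tj * vi)) + b * (Y + l * (ui * vj - uj * vi))
      lemma = solve-∀

    antisymmetric′ : ∀ c u v → form′ c u v ≡ - form′ c v u
    antisymmetric′ (l ∷ c) u v = begin
      form c (R u) (R v) + l * minor u v
        ≡⟨ cong (λ x → x + l * minor u v) (IsAlternating.antisymmetric (alternating c) (R u) (R v)) ⟩
      - form c (R v) (R u) + l * minor u v
        ≡⟨ lemma l (form c (R v) (R u)) (lookup u i) (lookup u j) (lookup v i) (lookup v j) ⟩
      - (form c (R v) (R u) + l * minor v u) ∎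
      where
      lemma : ∀ l X ui uj vi vj → - X + l * (ui * vj - uj * vi) ≡ - (X + l * (vi * uj - vj * ui))
      lemma = solve-∀

    linear′ : ∀ u v → Linear (λ c → form′ c u v)
    linear′ u v a (l ∷ c) b (m ∷ d) = begin
      form (combine a c b d) (R u) (R v) + (a * l + b * m) * minor u v
        ≡⟨ cong (λ x → x + (a * l + b * m) * minor u v) (linear (R u) (R v) a c b d) ⟩
      (a * form c (R u) (R v) + b * form d (R u) (R v)) + (a * l + b * m) * minor u v
        ≡⟨ lemma a b l m (form c (R u) (R v)) (form d (R u) (R v)) (minor u v) ⟩
      a * form′ (l ∷ c) u v + b * form′ (m ∷ d) u v ∎
      where
      lemma : ∀ a b l m X Y M → (a * X + b * Y) + (a * l + b * m) * M ≡ a * (X + l * M) + b * (Y + m * M)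
      lemma = solve-∀

    form′-T : ∀ l c u v → form′ (l ∷ c) (T u) v ≡ form c u (R v) + l * minor (T u) v
    form′-T l c u v = cong (λ r → form c r (R v) + l * minor (T u) v) (R∘T u)

    -- A piece missing from the union was unknown to both participants, so the old form kills `e i`
    -- and `e j`, hence their span, where `R (e i)` and `R (e j)` lie.
    combination-vanishes : ∀ c x a b → x ∉ s i ∪ s j → form c (y x) (combine a (e i) b (e j)) ≡ 0ℤ
    combination-vanishes c x a b x∉ = begin
      form c (y x) (combine a (e i) b (e j))
        ≡⟨ IsAlternating.linearʳ (alternating c) (y x) a (e i) b (e j) ⟩
      a * form c (y x) (e i) + b * form c (y x) (e j)
        ≡⟨ cong₂ (λ X Y → a * X + b * Y) (compatible c i (∉-∪ˡ (s i) (s j) x∉)) (compatible c j (∉-∪ʳ (s i) (s j) x∉)) ⟩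
      a * 0ℤ + b * 0ℤ
        ≡⟨ lemma a b ⟩
      0ℤ ∎
      where
      lemma : ∀ a b → a * 0ℤ + b * 0ℤ ≡ 0ℤ
      lemma = solve-∀

    minor-zeroˡ : ∀ l u v → lookup u i ≡ 0ℤ → lookup u j ≡ 0ℤ → l * minor u v ≡ 0ℤ
    minor-zeroˡ l u v ui≡0 uj≡0 = trans
      (cong₂ (λ a b → l * (a * lookup v j - b * lookup v i)) ui≡0 uj≡0) (lemma l (lookup v i) (lookup v j))
      where
      lemma : ∀ l a b → l * (0ℤ * b - 0ℤ * a) ≡ 0ℤ
      lemma = solve-∀

    minor-zeroʳ : ∀ l u v → lookup v i ≡ 0ℤ → lookup v j ≡ 0ℤ → l * minor u v ≡ 0ℤ
    minor-zeroʳ l u v vi≡0 vj≡0 = trans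
      (cong₂ (λ a b → l * (lookup u i * b - lookup u j * a)) vi≡0 vj≡0) (lemma l (lookup u i) (lookup u j))
      where
      lemma : ∀ l a b → l * (a * 0ℤ - b * 0ℤ) ≡ 0ℤ
      lemma = solve-∀

    -- The two summands vanish separately. For a participant, the minor vanishes because the new
    -- weights of `x` at `i` and `j` are both zero. For an outsider, `R` fixes `e p`, and the minor
    -- vanishes because `e p` has zero entries at `i` and `j`.
    compatible′ : ∀ c x p → x ∉ s′ p → form′ c (T (y x)) (e p) ≡ 0ℤ
    compatible′ (l ∷ c) x = coordinates i j
      (λ x∉′ → participant i 2ℤ -1ℤ (subst (x ∉_) (applyCall-i i≢j s) x∉′) R-e-i)
      (λ x∉′ → participant j -1ℤ 1ℤ (subst (x ∉_) (applyCall-j i≢j s) x∉′) R-e-j)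
      (λ {p} p≢i p≢j x∉′ → trans (form′-T l c (y x) (e p)) (cong₂ _+_
        (trans (cong (form c (y x)) (R-e-other p≢i p≢j))
               (compatible c p (subst (x ∉_) (applyCall-other i≢j s p≢i p≢j) x∉′)))
        (minor-zeroʳ l (T (y x)) (e p) (lookup-e-≢ p≢i) (lookup-e-≢ p≢j))))
      where
      module W′ = Weights (call-weights i≢j w)
      participant : ∀ p a b → x ∉ s i ∪ s j → R (e p) ≡ combine a (e i) b (e j) →
                    form′ (l ∷ c) (T (y x)) (e p) ≡ 0ℤ
      participant p a b x∉ R-e = trans (form′-T l c (y x) (e p)) (cong₂ _+_
        (trans (cong (form c (y x)) R-e) (combination-vanishes c x a b x∉))
        (minor-zeroˡ l (T (y x)) (e p)
          (W′.unknown i (subst (x ∉_) (sym (applyCall-i i≢j s)) x∉))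
          (W′.unknown j (subst (x ∉_) (sym (applyCall-j i≢j s)) x∉))))

    -- The minor is multiplied by the determinant of `T`, which is 1.
    minor-T : ∀ u v → minor (T u) (T v) ≡ minor u v
    minor-T u v = trans
      (cong₂ _-_ (cong₂ _*_ (T-i u) (T-j v)) (cong₂ _*_ (T-j u) (T-i v)))
      (lemma (lookup u i) (lookup u j) (lookup v i) (lookup v j))
      where
      lemma : ∀ ui uj vi vj →
        (1ℤ * ui + 1ℤ * uj) * (1ℤ * vi + 2ℤ * vj) - (1ℤ * ui + 2ℤ * uj) * (1ℤ * vi + 1ℤ * vj) ≡ ui * vj - uj * vi
      lemma = solve-∀

    module _ l c (vanishes : ∀ u v → form′ (l ∷ c) u v ≡ 0ℤ) where

      -- Evaluating at `T u` and `T v` undoes `R` and leaves the minor unchanged. Thus `l` times the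
      -- minor is the negative of an old form, and inherits compatibility with the state before the
      -- call.
      form+minor≡0 : ∀ u v → form c u v + l * minor u v ≡ 0ℤ
      form+minor≡0 u v = begin
        form c u v + l * minor u v              ≡⟨ cong₂ (λ x m → x + l * m) (cong (form c u) (R∘T v)) (minor-T u v) ⟨
        form c u (R (T v)) + l * minor (T u) (T v)  ≡⟨ form′-T l c u (T v) ⟨
        form′ (l ∷ c) (T u) (T v)               ≡⟨ vanishes (T u) (T v) ⟩
        0ℤ                                      ∎

      minor≡0 : ∀ {x} p → x ∉ s p → l * minor (y x) (e p) ≡ 0ℤ
      minor≡0 {x} p x∉ = begin
        l * minor (y x) (e p)                         ≡⟨ ℤₚ.+-identityˡ _ ⟨
        0ℤ + l * minor (y x) (e p)                    ≡⟨ cong (λ z → z + l * minor (y x) (e p)) (compatible c p x∉) ⟨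
        form c (y x) (e p) + l * minor (y x) (e p)    ≡⟨ form+minor≡0 (y x) (e p) ⟩
        0ℤ                                            ∎

      -- If `q` lacked a piece `x` known to `p`, compatibility of the minor would force the weight
      -- of `x` at `p` to be zero, against positivity.
      nonzero⇒⊆ : ∀ p q → l ≢ 0ℤ →
        (∀ x → l * minor (y x) (e q) ≡ 0ℤ → l * lookup (y x) p ≡ 0ℤ) → s p ⊆ s q
      nonzero⇒⊆ p q l≢0 weight {x} x∈p with x ∈? s q
      ... | yes x∈q = x∈q
      ... | no  x∉q with ℤₚ.i*j≡0⇒i≡0∨j≡0 l (weight x (minor≡0 q x∉q))
      ...   | inj₁ l≡0 = ⊥-elim (l≢0 l≡0)
      ...   | inj₂ y≡0 = ⊥-elim (ℤₚ.<⇒≢ (known p x∈p) (sym y≡0))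

      -- Pairing with `e i` extracts minus the coordinate at `j`; pairing with `e j`, below,
      -- extracts the coordinate at `i`.
      minor-e-i : ∀ x → l * minor (y x) (e i) ≡ 0ℤ → l * lookup (y x) j ≡ 0ℤ
      minor-e-i x eq = begin
        l * lookup (y x) j          ≡⟨ lemma l (lookup (y x) i) (lookup (y x) j) ⟩
        - (l * (lookup (y x) i * 0ℤ - lookup (y x) j * 1ℤ))
          ≡⟨ cong₂ (λ a b → - (l * (lookup (y x) i * a - lookup (y x) j * b))) (lookup-e-≢ i≢j) (lookup-e-≡ i) ⟨
        - (l * minor (y x) (e i))   ≡⟨ cong -_ eq ⟩
        0ℤ                          ∎
        where
        lemma : ∀ l a b → l * b ≡ - (l * (a * 0ℤ - b * 1ℤ))
        lemma = solve-∀

      minor-e-j : ∀ x → l * minor (y x) (e j) ≡ 0ℤ → l * lookup (y x) i ≡ 0ℤ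
      minor-e-j x eq = begin
        l * lookup (y x) i          ≡⟨ lemma l (lookup (y x) i) (lookup (y x) j) ⟩
        l * (lookup (y x) i * 1ℤ - lookup (y x) j * 0ℤ)
          ≡⟨ cong₂ (λ a b → l * (lookup (y x) i * a - lookup (y x) j * b)) (lookup-e-≡ j) (lookup-e-≢ (i≢j ∘ sym)) ⟨
        l * minor (y x) (e j)       ≡⟨ eq ⟩
        0ℤ                          ∎
        where
        lemma : ∀ l a b → l * a ≡ l * (a * 1ℤ - b * 0ℤ)
        lemma = solve-∀

      l≡0 : l ≡ 0ℤ
      l≡0 with l ≟ 0ℤ
      ... | yes l≡0 = l≡0
      -- A nonzero `l` would give both inclusions between `s i` and `s j`, while an informative call
      -- refutes one of them.
      ... | no  l≢0 = ⊥-elim ([ (λ sj⊈si → sj⊈si (nonzero⇒⊆ j i l≢0 minor-e-i))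
                              , (λ si⊈sj → si⊈sj (nonzero⇒⊆ i j l≢0 minor-e-j)) ]′ informative)

      form≡0 : ∀ u v → form c u v ≡ 0ℤ
      form≡0 u v = begin
        form c u v                     ≡⟨ lemma (form c u v) (minor u v) ⟩
        form c u v + 0ℤ * minor u v    ≡⟨ cong (λ l → form c u v + l * minor u v) l≡0 ⟨
        form c u v + l * minor u v     ≡⟨ form+minor≡0 u v ⟩
        0ℤ                             ∎
        where
        lemma : ∀ x m → x ≡ x + 0ℤ * m
        lemma = solve-∀

    faithful′ : ∀ c → (∀ u v → form′ c u v ≡ 0ℤ) → c ≡ 𝟎
    faithful′ (l ∷ c) vanishes = cong₂ _∷_ (l≡0 l c vanishes) (faithful c (form≡0 l c vanishes))

  call-forms : CompatibleForms s′ (T ∘ y) (suc k)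
  call-forms = record
    { form        = form′
    ; alternating = λ c → record { linearˡ = linearˡ′ c ; antisymmetric = antisymmetric′ c }
    ; linear      = linear′
    ; compatible  = λ c {x} → compatible′ c x
    ; faithful    = faithful′
    }

-- The sum of the dimension reached and the number of calls still to come is invariant; when no
-- calls remain, the dimension bound applies.
calls-bounded : ∀ {n s y k cs} → Weights {n} s y → CompatibleForms s y k → ValidSeq s cs →
                k ℕ.+ length cs ≤ n C 2
calls-bounded {n} {k = k} w F done = subst (_≤ n C 2) (sym (ℕₚ.+-identityʳ k)) (compatible-dimension F)
calls-bounded {n} {k = k} w F (step {c = i , j , i≢j} {cs} informative valid) =
  subst (_≤ n C 2) (sym (ℕₚ.+-suc k (length cs)))
    (calls-bounded (call-weights i≢j w) (call-forms i≢j w informative F) valid)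

-- A longest sequence of calls

-- Ensures that `p` may call `q` and hears something new, provided `q` still knows its own piece.
Ahead : ∀ {n} → State n → Fin n → Fin n → Set
Ahead s p q = p ≢ q × q ∉ s p

-- The outcome of `p` calling all of `qs` in order. `prefix` prepends these calls to any
-- continuation, `ahead` and `self` are the hypotheses of the next round, and `unchanged` drives the
-- induction in `sweep`.
record Swept {n} (s : State n) (p : Fin n) (qs : List (Fin n)) : Set where
  field
    after     : State n
    prefix    : ∀ {cs} → ValidSeq after cs →
                Σ (List (Call n)) λ cs′ → ValidSeq s cs′ × length cs′ ≡ length qs ℕ.+ length cs
    ahead     : AllPairs (Ahead after) qs
    self      : All (λ q → q ∈ after q) qs
    unchanged : ∀ {r} → r ≢ p → All (r ≢_) qs → after r ≡ s r

-- After `p` calls `q`, both know `s p ∪ s q`, which contains no piece of anyone later in the list,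
-- so both stay ahead of all of them.
sweep : ∀ {n} (s : State n) p qs → All (Ahead s p) qs → AllPairs (Ahead s) qs →
        All (λ q → q ∈ s q) qs → Swept s p qs
sweep s p [] _ _ _ = record
  { after     = s
  ; prefix    = λ {cs} valid → cs , valid , refl
  ; ahead     = []
  ; self      = []
  ; unchanged = λ _ _ → refl
  }
sweep {n} s p (q ∷ qs) ((p≢q , q∉sp) ∷ p-ahead) (q-ahead ∷ ahead) (q∈sq ∷ self) = record
  { after     = S.after
  ; prefix    = λ valid → let cs , valid′ , len = S.prefix valid in
      -- The piece `q` itself witnesses that `p` learns something.
      (p , q , p≢q) ∷ cs , step (inj₁ (λ sq⊆sp → q∉sp (sq⊆sp q∈sq))) valid′ , cong suc len
  ; ahead     = All.zipWith (λ ((p≢r , r∉sp) , (q≢r , r∉sq)) →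
                    q≢r , subst (_ ∉_) (sym after-q) (∉-union r∉sp r∉sq)) (p-ahead , q-ahead) ∷ S.ahead
  ; self      = subst (q ∈_) (sym after-q) (q⊆p∪q (s p) (s q) q∈sq) ∷ S.self
  ; unchanged = λ { r≢p (r≢q ∷ r≢qs) → trans (S.unchanged r≢p r≢qs) (applyCall-other p≢q s r≢p r≢q) }
  }
  where
  s₁ : State n
  s₁ = applyCall (p , q , p≢q) s

  ∉-union : ∀ {r} → r ∉ s p → r ∉ s q → r ∉ s p ∪ s q
  ∉-union r∉sp r∉sq r∈ with x∈p∪q⁻ (s p) (s q) r∈
  ... | inj₁ r∈sp = r∉sp r∈sp
  ... | inj₂ r∈sq = r∉sq r∈sq

  outsiders : All (λ r → p ≢ r × q ≢ r) qs
  outsiders = All.zipWith (λ ((p≢r , _) , (q≢r , _)) → p≢r , q≢r) (p-ahead , q-ahead)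

  same : ∀ {r} → p ≢ r × q ≢ r → s₁ r ≡ s r
  same (p≢r , q≢r) = applyCall-other p≢q s (p≢r ∘ sym) (q≢r ∘ sym)

  p-ahead₁ : All (Ahead s₁ p) qs
  p-ahead₁ = All.zipWith (λ ((p≢r , r∉sp) , (_ , r∉sq)) →
    p≢r , subst (_ ∉_) (sym (applyCall-i p≢q s)) (∉-union r∉sp r∉sq)) (p-ahead , q-ahead)

  ahead₁ : ∀ {rs} → All (λ r → p ≢ r × q ≢ r) rs → AllPairs (Ahead s) rs → AllPairs (Ahead s₁) rs
  ahead₁ [] [] = []
  ahead₁ (out ∷ outs) (r-ahead ∷ rest) =
    All.map (λ (r≢t , t∉sr) → r≢t , subst (_ ∉_) (sym (same out)) t∉sr) r-ahead ∷ ahead₁ outs rest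

  self₁ : All (λ r → r ∈ s₁ r) qs
  self₁ = All.zipWith (λ (out , r∈sr) → subst (_ ∈_) (sym (same out)) r∈sr) (outsiders , self)

  module S = Swept (sweep s₁ p qs p-ahead₁ (ahead₁ outsiders ahead) self₁)

  -- The call with `p` is the only one of the round that involves `q`.
  after-q : S.after q ≡ s p ∪ s q
  after-q = trans (S.unchanged (p≢q ∘ sym) (All.map proj₁ q-ahead)) (applyCall-j p≢q s)

-- The round of `p` makes `length ps` calls and leaves the same situation for `ps`; Pascal's rule
-- sums the rounds.
longest : ∀ {n} (s : State n) ps → AllPairs (Ahead s) ps → All (λ p → p ∈ s p) ps →
          Σ (List (Call n)) λ cs → ValidSeq s cs × length cs ≡ length ps C 2
longest s []       _                  _          = [] , done , refl
longest s (p ∷ ps) (p-ahead ∷ ahead) (_ ∷ self) =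
  let open Swept (sweep s p ps p-ahead ahead self) renaming (ahead to ahead′; self to self′)
      cs  , valid  , len  = longest after ps ahead′ self′
      cs′ , valid′ , len′ = prefix valid
  in cs′ , valid′ , trans len′ (trans (cong (length ps ℕ.+_) len) (pascal (length ps)))

theorem1p4 : (n : ℕ) → 1 ≤ n →
    ((cs : List (Call n)) → ValidSeq (initial n) cs → length cs ≤ n C 2)
    × Σ (List (Call n)) (λ cs → ValidSeq (initial n) cs × length cs ≡ n C 2)
theorem1p4 n _ =
  -- The initial dimension is 0, so the invariant sum is just the number of calls.
  (λ cs → calls-bounded initial-weights initial-forms) ,
  (let cs , valid , len = longest (initial n) (allFin n)
         (AllPairsₚ.tabulate⁺ (λ p≢q → p≢q , x≢y⇒x∉⁅y⁆ (p≢q ∘ sym)))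
         (Allₚ.tabulate⁺ x∈⁅x⁆)
   in cs , valid , trans len (cong (_C 2) (length-allFin n)))
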